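{- For every positive integer $m$ and every $j\in\{0,1,\dots,m\}$, one has $u^{m-j-\lfloor\frac{m+1}{2}\rfloor}\ell_{m,j}(u)\in\mathbb Z[u]$. Consequently, $u=0$ is a regular singular point of the differential equation $\widetilde L_mf(u)=0$, where $\widetilde L_m=\sum_{j=0}^m\ell_{m,j}(u)D^j$; hence for a suitably chosen $\delta_m\in(0,1)$ every solution $f(u)$, $u\in(0,\delta_m)$, is expressible as a convergent series in (fractional) powers of $u$ and $\log u$.
   Context: $D=\mathrm d/\mathrm du$ and $(\widehat\vartheta f)(u)=D[uf(u)]$. For $m\ge1$ the polynomials $\ell_{m,j}(u)\in\mathbb Z[u]$ ($0\le j\le m$) are defined by the operator identity $\sum_{j=0}^m\ell_{m,j}(u)D^j=u\widehat\vartheta^m+\sum_{k=1}^{\lfloor m/2\rfloor+1}u^{1-k}\sum_{(\alpha_1,\dots,\alpha_k)}(\widehat\vartheta-k)^{m+1-\alpha_1}\prod_{n=1}^k\alpha_n(\alpha_n-m-2)(\widehat\vartheta-k+n)^{\alpha_n-\alpha_{n+1}}$, the inner sum over integer tuples with $1\le\alpha_n\le m+1$, $\alpha_{n+1}\le\alpha_n-2$ for $1\le n\le k-1$, and $\alpha_{k+1}:=1$. -}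

module Defs where

open import Data.Nat as ℕ using (ℕ; zero; suc)
open import Data.Nat.Combinatorics using (_C_)
open import Data.Integer as ℤ using (ℤ; +_; _+_; _-_; _*_; -_)
open import Data.Bool using (Bool; true; false; _∧_)
open import Data.List using (List; []; _∷_; _++_; concatMap; map; filter; foldr; upTo)
open import Data.Product using (_×_; _,_)
open import Relation.Nullary.Decidable using (yes; no)
open import Relation.Binary.PropositionalEquality using (_≡_)
open import Relation.Nullary using (¬_)

-- Differential operators with Laurent-polynomial coefficients over ℤ.
-- A term  (c , a , j)  stands for the operator  c · u^a · D^j
-- (coefficient on the LEFT, i.e. normal-ordered).  An operator is a
-- formal finite sum (list) of terms; it need not be normalised, since
-- we only ever read off coefficients (which sums like terms).

Term : Set
Term = ℤ × ℤ × ℕ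

Op : Set
Op = List Term

falling : ℤ → ℕ → ℤ
falling b zero    = + 1
falling b (suc i) = falling b i * (b - + i)

_⊕_ : Op → Op → Op
P ⊕ Q = P ++ Q

-- product of two terms, by Leibniz:
--   (c u^a D^j)(d u^b D^k) = Σ_{i=0}^{j} c d C(j,i) b^(i falling) u^(a+b-i) D^(j-i+k)
termMul : Term → Term → Op
termMul (c , a , j) (d , b , k) =
  map (λ i → (c * d * + (j C i) * falling b i , a + b - + i , (j ℕ.∸ i) ℕ.+ k))
      (upTo (suc j))

_⊗_ : Op → Op → Op
P ⊗ Q = concatMap (λ s → concatMap (termMul s) Q) P

idOp : Op
idOp = (+ 1 , + 0 , 0) ∷ []

constOp : ℤ → Op
constOp c = (c , + 0 , 0) ∷ []

uPow : ℤ → Op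
uPow a = (+ 1 , a , 0) ∷ []

DOp : Op
DOp = (+ 1 , + 0 , 1) ∷ []

_^ᵒ_ : Op → ℕ → Op
P ^ᵒ zero  = idOp
P ^ᵒ suc n = P ⊗ (P ^ᵒ n)

ϑ̂ : Op
ϑ̂ = DOp ⊗ uPow (+ 1)

ϑ̂+ : ℤ → Op
ϑ̂+ c = ϑ̂ ⊕ constOp c

coeff : Op → ℤ → ℕ → ℤ
coeff P a j = foldr _+_ (+ 0) (map pick P)
  where
  pick : Term → ℤ
  pick (c , b , i) with b ℤ.≟ a | i ℕ.≟ j
  ... | yes _ | yes _ = c
  ... | _     | _     = + 0

allTuples : ℕ → ℕ → List (List ℕ)
allTuples m zero    = [] ∷ []
allTuples m (suc k) =
  concatMap (λ a → map (a ∷_) (allTuples m k)) (map suc (upTo (suc m)))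

gapsOK : List ℕ → Bool
gapsOK []           = true
gapsOK (a ∷ [])     = true
gapsOK (a ∷ b ∷ as) = ((b ℕ.+ 2) ℕ.≤ᵇ a) ∧ gapsOK (b ∷ as)

admissible : ℕ → ℕ → List (List ℕ)
admissible m k = filter (λ α → gapsOK α Data.Bool.≟ true) (allTuples m k)
  where import Data.Bool

-- ∏_{n=start}^{k} αₙ(αₙ-m-2) (ϑ̂-k+n)^{αₙ-α_{n+1}}, with α_{k+1} := 1;
-- the list argument is (α_start, …, α_k).
prodPart : ℕ → ℕ → ℕ → List ℕ → Op
prodPart m k n []           = idOp
prodPart m k n (a ∷ rest)   =
  (constOp (+ a * (+ a - + (m ℕ.+ 2))) ⊗ (ϑ̂+ (+ n - + k) ^ᵒ (a ℕ.∸ next rest)))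
    ⊗ prodPart m k (suc n) rest
  where
  next : List ℕ → ℕ
  next []      = 1
  next (b ∷ _) = b

tupleTerm : ℕ → ℕ → List ℕ → Op
tupleTerm m k []          = []      -- never occurs (k ≥ 1)
tupleTerm m k (a₁ ∷ rest) =
  (ϑ̂+ (- + k) ^ᵒ (suc m ℕ.∸ a₁)) ⊗ prodPart m k 1 (a₁ ∷ rest)

⨁ : List Op → Op
⨁ = foldr _⊕_ []

L̃ : ℕ → Op
L̃ m = (uPow (+ 1) ⊗ (ϑ̂ ^ᵒ m))
    ⊕ ⨁ (map (λ k → uPow (+ 1 - + k) ⊗ ⨁ (map (tupleTerm m k) (admissible m k)))
             (map suc (upTo (suc ℕ.⌊ m /2⌋))))

-- ℓ_{m,j}, as a Laurent polynomial given by its coefficient function: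
-- ℓ m j a = coefficient of u^a in ℓ_{m,j}(u)
ℓ : ℕ → ℕ → ℤ → ℤ
ℓ m j a = coeff (L̃ m) a j

-- u^e · p(u) ∈ ℤ[u]  : no negative powers after multiplying by u^e
MulPowIsPoly : ℤ → (ℤ → ℤ) → Set
MulPowIsPoly e p = ∀ (a : ℤ) → a + e ℤ.< + 0 → p a ≡ + 0

HasOrder : (ℤ → ℤ) → ℤ → Set
HasOrder p r = ¬ (p r ≡ + 0) × (∀ (a : ℤ) → a ℤ.< r → p a ≡ + 0)

-- u = 0 is a regular singular point of  Σ_{j=0}^m c_j(u) D^j f = 0
-- (c_j Laurent polynomials, c j a = coefficient of u^a in c_j):
-- the leading coefficient c_m is nonzero and every u^{m-j} c_j / c_m is
-- analytic at 0, i.e. ord₀ c_j ≥ ord₀ c_m - (m - j).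
RegularSingularAtZero : ℕ → (ℕ → ℤ → ℤ) → Set
RegularSingularAtZero m c =
  Data.Product.Σ ℤ λ r → HasOrder (c m) r ×
    (∀ (j : ℕ) → j ℕ.≤ m → ∀ (a : ℤ) → a ℤ.< r - (+ m - + j) → c j a ≡ + 0)
  where import Data.Product

{-# OPTIONS --safe #-}
-- Give the term c u^b D^i the weight b − i.  Then ϑ̂ = D u = u D + 1 has weight 0, so
-- L̃_m = u ϑ̂^m + Σ_{k=1}^{⌊m/2⌋+1} u^{1−k} T_k (T_k the sum over admissible k-tuples)
-- splits into homogeneous parts of weights 1, 0, …, −⌊m/2⌋, and every term u^a D^j of
-- L̃_m has a ≥ j − ⌊m/2⌋ = j − m + ⌈m/2⌉.  This is the polynomiality claim, and also
-- ord ℓ_{m,j} ≥ ⌈m/2⌉ − (m − j).  It remains to see that the coefficient of u^⌈m/2⌉ D^m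
-- is nonzero.  Only the lowest part (k = ⌊m/2⌋+1) contributes to it.  There every summand
-- is a product of m factors ϑ̂ + const, whose top-order symbol is (uD)^m, times
-- ∏ αₙ(αₙ − m − 2).  Since 1 ≤ αₙ ≤ m + 1 every factor is negative, so all summands have
-- the sign (−1)^k and cannot cancel, and the tuple (2k − 1, …, 3, 1) shows that the sum
-- is not empty.
module Submission where

open import Defs
open import Data.Nat using (ℕ; suc; _≤_; ⌊_/2⌋)
open import Data.Integer using (+_; _-_)
open import Data.Product using (_×_)

open import Data.Bool as Bool using (true; T)
open import Data.Bool.Properties using (T-≡; T-∧)
open import Data.Integer as ℤ using (ℤ; _+_; _*_; -_; -1ℤ)
import Data.Integer.Properties as ℤ
open import Data.Integer.Tactic.RingSolver using (solve-∀)
open import Data.List using (List; []; _∷_; _++_; _∷ʳ_; concatMap; map; foldr; length; upTo; applyUpTo)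
open import Data.List.Membership.Propositional using (_∈_; lose)
open import Data.List.Membership.Propositional.Properties using (∈-concatMap⁺; ∈-map⁺; ∈-applyUpTo⁺; ∈-filter⁺)
open import Data.List.Properties using (map-cong; map-++; ++-identityʳ; applyUpTo-∷ʳ; concat-++)
open import Data.List.Relation.Unary.All as All using (All; []; _∷_)
open import Data.List.Relation.Unary.All.Properties
  using (concat⁺; map⁺; applyUpTo⁺₁; ++⁺; all-upTo; filter⁺; all-filter)
open import Data.List.Relation.Unary.Any using (here)
import Data.List.Relation.Unary.Any.Properties as Any
open import Data.List.Relation.Unary.Linked as Linked using (Linked; []; [-]; _∷_)
open import Data.Nat as ℕ using (zero; _<_; _≥_; z≤n; s≤s; ⌈_/2⌉)
open import Data.Nat.Combinatorics using (_C_)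
import Data.Nat.Properties as ℕ
open import Data.Nat.Tactic.RingSolver renaming (solve-∀ to ℕ-solve-∀)
open import Data.Product using (Σ; ∃-syntax; _,_; proj₁; proj₂)
open import Function using (_∘_; id; Equivalence)
open import Relation.Binary.PropositionalEquality
open import Relation.Nullary using (Dec; yes; no; contradiction)
open import Relation.Unary using (Decidable)

-- Coefficients of operators

exponent : Term → ℤ
exponent (_ , b , _) = b

order : Term → ℕ
order (_ , _ , i) = i

termCoeff : ℤ → ℕ → Term → ℤ
termCoeff a j (c , b , i) with b ℤ.≟ a | i ℕ.≟ j
... | yes _ | yes _ = c
... | _     | _     = + 0

termCoeff-self : ∀ a j c → termCoeff a j (c , a , j) ≡ c
termCoeff-self a j c with a ℤ.≟ a | j ℕ.≟ j
... | yes _ | yes _  = refl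
... | no a≢a | _     = contradiction refl a≢a
... | yes _ | no j≢j = contradiction refl j≢j

termCoeff-miss : ∀ {a j} t → (exponent t ≡ a → order t ≢ j) → termCoeff a j t ≡ + 0
termCoeff-miss {a} {j} (c , b , i) miss with b ℤ.≟ a | i ℕ.≟ j
... | yes b≡a | yes i≡j = contradiction i≡j (miss b≡a)
... | yes _   | no _    = refl
... | no _    | _       = refl

-- `coeff` sums a function local to its definition; unification names it.
coeff-summand : ∀ P a j → Σ (Term → ℤ) λ f → coeff P a j ≡ foldr _+_ (+ 0) (map f P)
coeff-summand P a j = _ , refl

coeff-summand≗termCoeff : ∀ P a j → proj₁ (coeff-summand P a j) ≗ termCoeff a j
coeff-summand≗termCoeff P a j (c , b , i) with b ℤ.≟ a | i ℕ.≟ j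
... | yes _ | yes _ = refl
... | yes _ | no _  = refl
... | no _  | _     = refl

coeff-as-sum : ∀ P a j → coeff P a j ≡ foldr _+_ (+ 0) (map (termCoeff a j) P)
coeff-as-sum P a j =
  trans (proj₂ (coeff-summand P a j)) (cong (foldr _+_ (+ 0)) (map-cong (coeff-summand≗termCoeff P a j) P))

coeff-∷ : ∀ t P a j → coeff (t ∷ P) a j ≡ termCoeff a j t + coeff P a j
coeff-∷ t P a j = trans (coeff-as-sum (t ∷ P) a j) (cong (_+_ (termCoeff a j t)) (sym (coeff-as-sum P a j)))

coeff-++ : ∀ P Q a j → coeff (P ++ Q) a j ≡ coeff P a j + coeff Q a j
coeff-++ [] Q a j = sym (ℤ.+-identityˡ _)
coeff-++ (t ∷ P) Q a j = begin
  coeff (t ∷ P ++ Q) a j                         ≡⟨ coeff-∷ t (P ++ Q) a j ⟩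
  termCoeff a j t + coeff (P ++ Q) a j           ≡⟨ cong (_+_ (termCoeff a j t)) (coeff-++ P Q a j) ⟩
  termCoeff a j t + (coeff P a j + coeff Q a j)  ≡⟨ ℤ.+-assoc (termCoeff a j t) _ _ ⟨
  (termCoeff a j t + coeff P a j) + coeff Q a j  ≡⟨ cong (_+ coeff Q a j) (coeff-∷ t P a j) ⟨
  coeff (t ∷ P) a j + coeff Q a j                ∎
  where open ≡-Reasoning

coeff-vanishes : ∀ {a j} P → All (λ t → termCoeff a j t ≡ + 0) P → coeff P a j ≡ + 0
coeff-vanishes [] [] = refl
coeff-vanishes {a} {j} (t ∷ P) (t↦0 ∷ P↦0) =
  trans (coeff-∷ t P a j) (cong₂ _+_ t↦0 (coeff-vanishes P P↦0))

-- Weight, order and leading symbol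

Homogeneous : ℤ → Op → Set
Homogeneous w = All (λ t → exponent t ≡ w + + order t)

WeightAtLeast : ℤ → Op → Set
WeightAtLeast w = All (λ t → w + + order t ℤ.≤ exponent t)

OrderAtMost : ℕ → Op → Set
OrderAtMost d = All (λ t → order t ≤ d)

homogeneous⇒weightAtLeast : ∀ {v w P} → v ℤ.≤ w → Homogeneous w P → WeightAtLeast v P
homogeneous⇒weightAtLeast v≤w = All.map (λ {t} eq → subst (ℤ._≤_ _) (sym eq) (ℤ.+-monoˡ-≤ (+ order t) v≤w))

coeff-below-weight : ∀ {w a j} P → WeightAtLeast w P → a ℤ.< w + + j → coeff P a j ≡ + 0
coeff-below-weight {w} {a} {j} P ws a<w+j = coeff-vanishes P (All.map (λ {t} → vanish t) ws)
  where
  vanish : ∀ t → w + + order t ℤ.≤ exponent t → termCoeff a j t ≡ + 0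
  vanish (c , b , i) w+i≤b = termCoeff-miss (c , b , i) λ { refl refl → ℤ.<⇒≱ a<w+j w+i≤b }

All-⊗ : ∀ {R : Term → Set} {P Q} → All (λ s → All (λ t → All R (termMul s t)) Q) P → All R (P ⊗ Q)
All-⊗ = concat⁺ ∘ map⁺ ∘ All.map (concat⁺ ∘ map⁺)

pos-∸ : ∀ {i j} → i ≤ j → + (j ℕ.∸ i) ≡ + j - + i
pos-∸ {i} {j} i≤j = sym (trans (ℤ.m-n≡m⊖n j i) (ℤ.⊖-≥ i≤j))

termMul-homogeneous : ∀ {w₁ w₂} s t → exponent s ≡ w₁ + + order s → exponent t ≡ w₂ + + order t →
  Homogeneous (w₁ + w₂) (termMul s t)
termMul-homogeneous {w₁} {w₂} (c , _ , j) (e , _ , k) refl refl =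
  map⁺ (applyUpTo⁺₁ id (suc j) λ {i} i<1+j → begin
    (w₁ + + j) + (w₂ + + k) - + i     ≡⟨ regroup w₁ w₂ (+ j) (+ k) (+ i) ⟩
    (w₁ + w₂) + ((+ j - + i) + + k)   ≡⟨ cong (λ x → (w₁ + w₂) + (x + + k)) (pos-∸ (ℕ.≤-pred i<1+j)) ⟨
    (w₁ + w₂) + (+ (j ℕ.∸ i) + + k)   ≡⟨ cong (_+_ (w₁ + w₂)) (ℤ.pos-+ (j ℕ.∸ i) k) ⟨
    (w₁ + w₂) + + (j ℕ.∸ i ℕ.+ k)     ∎)
  where
  open ≡-Reasoning
  regroup : ∀ (w₁ w₂ j k i : ℤ) → (w₁ + j) + (w₂ + k) - i ≡ (w₁ + w₂) + ((j - i) + k)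
  regroup = solve-∀

termMul-orderAtMost : ∀ {d₁ d₂} s t → order s ≤ d₁ → order t ≤ d₂ → OrderAtMost (d₁ ℕ.+ d₂) (termMul s t)
termMul-orderAtMost (c , _ , j) (e , _ , k) j≤d₁ k≤d₂ =
  map⁺ (applyUpTo⁺₁ id (suc j) λ {i} _ → ℕ.+-mono-≤ (ℕ.≤-trans (ℕ.m∸n≤m j i) j≤d₁) k≤d₂)

termMul-leading : ∀ {w₁ w₂ d₁ d₂} s t →
  exponent s ≡ w₁ + + order s → order s ≤ d₁ → exponent t ≡ w₂ + + order t → order t ≤ d₂ →
  coeff (termMul s t) ((w₁ + w₂) + + (d₁ ℕ.+ d₂)) (d₁ ℕ.+ d₂)
    ≡ termCoeff (w₁ + + d₁) d₁ s * termCoeff (w₂ + + d₂) d₂ t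
termMul-leading {w₁} {w₂} {d₁} {d₂} (c , _ , j) (e , _ , k) refl j≤d₁ refl k≤d₂ =
  trans (coeff-∷ head tail a d) (trans (cong₂ _+_ (top (j ℕ.≟ d₁) (k ℕ.≟ d₂)) tail-vanishes) (ℤ.+-identityʳ _))
  where
  open ≡-Reasoning
  a = (w₁ + w₂) + + (d₁ ℕ.+ d₂)
  d = d₁ ℕ.+ d₂
  s = (c , w₁ + + j , j)
  t = (e , w₂ + + k , k)
  head = c * e * + 1 * + 1 , (w₁ + + j) + (w₂ + + k) - + 0 , j ℕ.+ k
  term : ℕ → Term
  term i = c * e * + (j C i) * falling (w₂ + + k) i , (w₁ + + j) + (w₂ + + k) - + i , (j ℕ.∸ i) ℕ.+ k
  tail = map term (applyUpTo suc j)

  tail-vanishes : coeff tail a d ≡ + 0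
  tail-vanishes = coeff-vanishes tail (map⁺ (applyUpTo⁺₁ suc j λ {i} i<j → termCoeff-miss (term (suc i)) λ _ eq →
    ℕ.<-irrefl eq (ℕ.<-≤-trans (ℕ.+-monoˡ-< k (ℕ.∸-monoʳ-< (s≤s z≤n) i<j)) (ℕ.+-mono-≤ j≤d₁ k≤d₂))))

  regroup : ∀ (w₁ w₂ j k : ℤ) → (w₁ + j) + (w₂ + k) - + 0 ≡ (w₁ + w₂) + (j + k)
  regroup = solve-∀

  top : Dec (j ≡ d₁) → Dec (k ≡ d₂) → termCoeff a d head ≡ termCoeff (w₁ + + d₁) d₁ s * termCoeff (w₂ + + d₂) d₂ t
  top (yes refl) (yes refl) = begin
    termCoeff a d head
      ≡⟨ cong (λ b → termCoeff a d (c * e * + 1 * + 1 , b , d))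
              (trans (regroup w₁ w₂ (+ j) (+ k)) (cong (_+_ (w₁ + w₂)) (sym (ℤ.pos-+ j k)))) ⟩
    termCoeff a d (c * e * + 1 * + 1 , a , d)
      ≡⟨ termCoeff-self a d _ ⟩
    c * e * + 1 * + 1
      ≡⟨ trans (ℤ.*-identityʳ _) (ℤ.*-identityʳ _) ⟩
    c * e
      ≡⟨ cong₂ _*_ (termCoeff-self (w₁ + + j) j c) (termCoeff-self (w₂ + + k) k e) ⟨
    termCoeff (w₁ + + j) j s * termCoeff (w₂ + + k) k t ∎
  top (no j≢d₁) _ =
    trans (termCoeff-miss head λ _ → ℕ.<⇒≢ (ℕ.+-mono-<-≤ (ℕ.≤∧≢⇒< j≤d₁ j≢d₁) k≤d₂))
          (sym (cong (_* termCoeff (w₂ + + d₂) d₂ t) (termCoeff-miss s λ _ → j≢d₁)))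
  top (yes _) (no k≢d₂) =
    trans (termCoeff-miss head λ _ → ℕ.<⇒≢ (ℕ.+-mono-≤-< j≤d₁ (ℕ.≤∧≢⇒< k≤d₂ k≢d₂)))
          (sym (trans (cong (termCoeff (w₁ + + d₁) d₁ s *_) (termCoeff-miss t λ _ → k≢d₂)) (ℤ.*-zeroʳ (termCoeff (w₁ + + d₁) d₁ s))))

coeff-⊗ : ∀ {a j a₁ j₁ a₂ j₂} P Q →
  All (λ s → All (λ t → coeff (termMul s t) a j ≡ termCoeff a₁ j₁ s * termCoeff a₂ j₂ t) Q) P →
  coeff (P ⊗ Q) a j ≡ coeff P a₁ j₁ * coeff Q a₂ j₂
coeff-⊗ [] Q [] = refl
coeff-⊗ {a} {j} {a₁} {j₁} {a₂} {j₂} (s ∷ P) Q (row ∷ rows) = begin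
  coeff (concatMap (termMul s) Q ++ P ⊗ Q) a j
    ≡⟨ coeff-++ (concatMap (termMul s) Q) (P ⊗ Q) a j ⟩
  coeff (concatMap (termMul s) Q) a j + coeff (P ⊗ Q) a j
    ≡⟨ cong₂ _+_ (coeff-row Q row) (coeff-⊗ P Q rows) ⟩
  termCoeff a₁ j₁ s * coeff Q a₂ j₂ + coeff P a₁ j₁ * coeff Q a₂ j₂
    ≡⟨ ℤ.*-distribʳ-+ (coeff Q a₂ j₂) (termCoeff a₁ j₁ s) (coeff P a₁ j₁) ⟨
  (termCoeff a₁ j₁ s + coeff P a₁ j₁) * coeff Q a₂ j₂
    ≡⟨ cong (_* coeff Q a₂ j₂) (coeff-∷ s P a₁ j₁) ⟨
  coeff (s ∷ P) a₁ j₁ * coeff Q a₂ j₂ ∎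
  where
  open ≡-Reasoning
  coeff-row : ∀ Q → All (λ t → coeff (termMul s t) a j ≡ termCoeff a₁ j₁ s * termCoeff a₂ j₂ t) Q →
    coeff (concatMap (termMul s) Q) a j ≡ termCoeff a₁ j₁ s * coeff Q a₂ j₂
  coeff-row [] [] = sym (ℤ.*-zeroʳ (termCoeff a₁ j₁ s))
  coeff-row (t ∷ Q) (st ∷ sQ) = begin
    coeff (termMul s t ++ concatMap (termMul s) Q) a j
      ≡⟨ coeff-++ (termMul s t) (concatMap (termMul s) Q) a j ⟩
    coeff (termMul s t) a j + coeff (concatMap (termMul s) Q) a j
      ≡⟨ cong₂ _+_ st (coeff-row Q sQ) ⟩
    termCoeff a₁ j₁ s * termCoeff a₂ j₂ t + termCoeff a₁ j₁ s * coeff Q a₂ j₂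
      ≡⟨ ℤ.*-distribˡ-+ (termCoeff a₁ j₁ s) (termCoeff a₂ j₂ t) (coeff Q a₂ j₂) ⟨
    termCoeff a₁ j₁ s * (termCoeff a₂ j₂ t + coeff Q a₂ j₂)
      ≡⟨ cong (termCoeff a₁ j₁ s *_) (coeff-∷ t Q a₂ j₂) ⟨
    termCoeff a₁ j₁ s * coeff (t ∷ Q) a₂ j₂ ∎

-- P = u^w (σ ϑ^d + lower order in ϑ = u D)  with  ϑ^d = u^d D^d + lower order in D.
record HasSymbol (w : ℤ) (d : ℕ) (σ : ℤ) (P : Op) : Set where
  field
    homogeneous : Homogeneous w P
    orderAtMost : OrderAtMost d P
    leading     : coeff P (w + + d) d ≡ σ

open HasSymbol

HasSymbol-cong : ∀ {w d d′ σ σ′ P} → d ≡ d′ → σ ≡ σ′ → HasSymbol w d σ P → HasSymbol w d′ σ′ P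
HasSymbol-cong refl refl S = S

⊗-homogeneous : ∀ {w₁ w₂ P Q} → Homogeneous w₁ P → Homogeneous w₂ Q → Homogeneous (w₁ + w₂) (P ⊗ Q)
⊗-homogeneous {w₁} {w₂} hP hQ =
  All-⊗ (All.map (λ {s} hs → All.map (λ {t} → termMul-homogeneous {w₁} {w₂} s t hs) hQ) hP)

⊗-symbol : ∀ {w₁ w₂ d₁ d₂ σ₁ σ₂ P Q} → HasSymbol w₁ d₁ σ₁ P → HasSymbol w₂ d₂ σ₂ Q →
  HasSymbol (w₁ + w₂) (d₁ ℕ.+ d₂) (σ₁ * σ₂) (P ⊗ Q)
⊗-symbol {w₁} {w₂} {d₁} {d₂} {P = P} {Q} SP SQ = record
  { homogeneous = ⊗-homogeneous {w₁} {w₂} (homogeneous SP) (homogeneous SQ)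
  ; orderAtMost = All-⊗ (All.map (λ {s} os → All.map (λ {t} → termMul-orderAtMost {d₁} {d₂} s t os) (orderAtMost SQ))
                                 (orderAtMost SP))
  ; leading     = trans (coeff-⊗ P Q (All.zipWith row (homogeneous SP , orderAtMost SP)))
                        (cong₂ _*_ (leading SP) (leading SQ))
  }
  where
  row : ∀ {s} → exponent s ≡ w₁ + + order s × order s ≤ d₁ →
    All (λ t → coeff (termMul s t) ((w₁ + w₂) + + (d₁ ℕ.+ d₂)) (d₁ ℕ.+ d₂)
                 ≡ termCoeff (w₁ + + d₁) d₁ s * termCoeff (w₂ + + d₂) d₂ t) Q
  row {s} (hs , os) = All.zipWith (λ {t} (ht , ot) → termMul-leading {w₁} {w₂} {d₁} {d₂} s t hs os ht ot)
                                  (homogeneous SQ , orderAtMost SQ)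

++-symbol : ∀ {w d σ₁ σ₂ P Q} → HasSymbol w d σ₁ P → HasSymbol w d σ₂ Q → HasSymbol w d (σ₁ + σ₂) (P ++ Q)
++-symbol {w} {d} {P = P} {Q} SP SQ = record
  { homogeneous = ++⁺ (homogeneous SP) (homogeneous SQ)
  ; orderAtMost = ++⁺ (orderAtMost SP) (orderAtMost SQ)
  ; leading     = trans (coeff-++ P Q (w + + d) d) (cong₂ _+_ (leading SP) (leading SQ))
  }

coeff-singleton : ∀ t a j → coeff (t ∷ []) a j ≡ termCoeff a j t
coeff-singleton t a j = trans (coeff-∷ t [] a j) (ℤ.+-identityʳ _)

constOp-symbol : ∀ c → HasSymbol (+ 0) 0 c (constOp c)
constOp-symbol c = record { homogeneous = refl ∷ [] ; orderAtMost = z≤n ∷ [] ; leading = ℤ.+-identityʳ c }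

idOp-symbol : HasSymbol (+ 0) 0 (+ 1) idOp
idOp-symbol = constOp-symbol (+ 1)

uPow-symbol : ∀ a → HasSymbol a 0 (+ 1) (uPow a)
uPow-symbol a = record
  { homogeneous = sym (ℤ.+-identityʳ a) ∷ []
  ; orderAtMost = z≤n ∷ []
  ; leading     = trans (cong (λ b → coeff (uPow a) b 0) (ℤ.+-identityʳ a))
                        (trans (coeff-singleton (+ 1 , a , 0) a 0) (termCoeff-self a 0 (+ 1)))
  }

ϑ̂-symbol : HasSymbol (+ 0) 1 (+ 1) ϑ̂
ϑ̂-symbol = record { homogeneous = refl ∷ refl ∷ [] ; orderAtMost = ℕ.≤-refl ∷ z≤n ∷ [] ; leading = refl }

ϑ̂+-symbol : ∀ c → HasSymbol (+ 0) 1 (+ 1) (ϑ̂+ c)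
ϑ̂+-symbol c = ++-symbol ϑ̂-symbol (record { homogeneous = refl ∷ [] ; orderAtMost = z≤n ∷ [] ; leading = refl })

^ᵒ-symbol : ∀ {d σ P} n → HasSymbol (+ 0) d σ P → HasSymbol (+ 0) (n ℕ.* d) (σ ℤ.^ n) (P ^ᵒ n)
^ᵒ-symbol zero    S = idOp-symbol
^ᵒ-symbol (suc n) S = ⊗-symbol S (^ᵒ-symbol n S)

ϑ̂+^-symbol : ∀ c n → HasSymbol (+ 0) n (+ 1) (ϑ̂+ c ^ᵒ n)
ϑ̂+^-symbol c n = HasSymbol-cong (ℕ.*-identityʳ n) (ℤ.^-zeroˡ n) (^ᵒ-symbol n (ϑ̂+-symbol c))

-- The summands indexed by tuples α

tupleFactor : ℕ → ℕ → ℤ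
tupleFactor m a = + a * (+ a - + (m ℕ.+ 2))

tupleProduct : ℕ → List ℕ → ℤ
tupleProduct m []      = + 1
tupleProduct m (a ∷ α) = tupleFactor m a * tupleProduct m α

prodOrder : List ℕ → ℕ
prodOrder []          = 0
prodOrder (a ∷ [])    = a ℕ.∸ 1
prodOrder (a ∷ b ∷ α) = (a ℕ.∸ b) ℕ.+ prodOrder (b ∷ α)

prodPart-symbol : ∀ m k n α → HasSymbol (+ 0) (prodOrder α) (tupleProduct m α) (prodPart m k n α)
prodPart-symbol m k n [] = idOp-symbol
prodPart-symbol m k n (a ∷ []) =
  HasSymbol-cong (ℕ.+-identityʳ (a ℕ.∸ 1)) (ℤ.*-identityʳ (tupleFactor m a * + 1))
    (⊗-symbol (⊗-symbol (constOp-symbol (tupleFactor m a)) (ϑ̂+^-symbol (+ n - + k) (a ℕ.∸ 1))) idOp-symbol)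
prodPart-symbol m k n (a ∷ b ∷ α) =
  HasSymbol-cong refl (cong (_* tupleProduct m (b ∷ α)) (ℤ.*-identityʳ (tupleFactor m a)))
    (⊗-symbol (⊗-symbol (constOp-symbol (tupleFactor m a)) (ϑ̂+^-symbol (+ n - + k) (a ℕ.∸ b)))
              (prodPart-symbol m k (suc n) (b ∷ α)))

tupleTerm-symbol : ∀ m k a α →
  HasSymbol (+ 0) ((suc m ℕ.∸ a) ℕ.+ prodOrder (a ∷ α)) (+ 1 * tupleProduct m (a ∷ α)) (tupleTerm m k (a ∷ α))
tupleTerm-symbol m k a α = ⊗-symbol (ϑ̂+^-symbol (- + k) (suc m ℕ.∸ a)) (prodPart-symbol m k 1 (a ∷ α))

tupleTerm-homogeneous : ∀ m k α → Homogeneous (+ 0) (tupleTerm m k α)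
tupleTerm-homogeneous m k []      = []
tupleTerm-homogeneous m k (a ∷ α) = homogeneous (tupleTerm-symbol m k a α)

∸-telescope : ∀ {a b c} → c ≤ b → b ≤ a → (a ℕ.∸ b) ℕ.+ (b ℕ.∸ c) ≡ a ℕ.∸ c
∸-telescope {a} {b} {c} c≤b b≤a = trans (sym (ℕ.+-∸-assoc (a ℕ.∸ b) c≤b)) (cong (ℕ._∸ c) (ℕ.m∸n+n≡m b≤a))

prodOrder-descending : ∀ {a α} → Linked _≥_ (a ∷ α) → All (1 ≤_) (a ∷ α) → prodOrder (a ∷ α) ≡ a ℕ.∸ 1
prodOrder-descending [-]                  _                 = refl
prodOrder-descending {a} {b ∷ α} (b≤a ∷ desc) (_ ∷ pos@(1≤b ∷ _)) =
  trans (cong ((a ℕ.∸ b) ℕ.+_) (prodOrder-descending desc pos)) (∸-telescope 1≤b b≤a)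

record OfSign (k : ℕ) (v : ℤ) : Set where
  constructor signed
  field
    {magnitude} : ℕ
    sign≡ : -1ℤ ℤ.^ k * v ≡ + suc magnitude

ofSign⇒≢0 : ∀ {k v} → OfSign k v → v ≢ + 0
ofSign⇒≢0 {k} (signed eq) refl with () ← trans (sym (ℤ.*-zeroʳ (-1ℤ ℤ.^ k))) eq

ofSign-+ : ∀ {k v₁ v₂} → OfSign k v₁ → OfSign k v₂ → OfSign k (v₁ + v₂)
ofSign-+ {k} {v₁} {v₂} (signed eq₁) (signed eq₂) =
  signed (trans (ℤ.*-distribˡ-+ (-1ℤ ℤ.^ k) v₁ v₂) (cong₂ _+_ eq₁ eq₂))

ofSign-neg* : ∀ {k v} p → OfSign k v → OfSign (suc k) (- + suc p * v)
ofSign-neg* {k} {v} p (signed eq) = signed (trans (swap-signs (-1ℤ ℤ.^ k) (+ suc p) v) (cong (+ suc p *_) eq))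
  where
  swap-signs : ∀ s x v → (- + 1 * s) * (- x * v) ≡ x * (s * v)
  swap-signs = solve-∀

InRange : ℕ → ℕ → Set
InRange m a = 1 ≤ a × a ≤ suc m

tupleFactor-negative : ∀ {m a} → InRange m a → ∃[ p ] tupleFactor m a ≡ - + suc p
tupleFactor-negative {m} {suc a} (_ , s≤s a≤m) = r ℕ.+ a ℕ.* suc r , (begin
  + suc a * (+ suc a - + (m ℕ.+ 2))
    ≡⟨ cong (λ n → + suc a * (+ suc a - + (n ℕ.+ 2))) (ℕ.m+[n∸m]≡n a≤m) ⟨
  + suc a * (+ suc a - + (a ℕ.+ r ℕ.+ 2))
    ≡⟨ cong (λ x → + suc a * (+ suc a - x)) (trans (ℤ.pos-+ (a ℕ.+ r) 2) (cong (_+ + 2) (ℤ.pos-+ a r))) ⟩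
  + suc a * (+ suc a - ((+ a + + r) + + 2))
    ≡⟨ expand (+ a) (+ r) ⟩
  - (+ suc a * + suc r) ∎)
  where
  open ≡-Reasoning
  r = m ℕ.∸ a
  expand : ∀ a r → (+ 1 + a) * ((+ 1 + a) - ((a + r) + + 2)) ≡ - ((+ 1 + a) * (+ 1 + r))
  expand = solve-∀

tupleProduct-sign : ∀ {m α} → All (InRange m) α → OfSign (length α) (tupleProduct m α)
tupleProduct-sign []            = signed refl
tupleProduct-sign {m} {a ∷ α} (a∈ ∷ α∈) with p , eq ← tupleFactor-negative a∈ =
  subst (OfSign (suc (length α))) (cong (_* tupleProduct m α) (sym eq)) (ofSign-neg* p (tupleProduct-sign α∈))

Gapped : List ℕ → Set
Gapped = Linked (λ a b → b ℕ.+ 2 ≤ a)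

record IsAdmissible (m k : ℕ) (α : List ℕ) : Set where
  field
    length≡ : length α ≡ k
    inRange : All (InRange m) α
    gapped  : Gapped α

open IsAdmissible

gapsOK-sound : ∀ α → T (gapsOK α) → Gapped α
gapsOK-sound []          _  = []
gapsOK-sound (a ∷ [])    _  = [-]
gapsOK-sound (a ∷ b ∷ α) ok =
  ℕ.≤ᵇ⇒≤ (b ℕ.+ 2) a (proj₁ (Equivalence.to T-∧ ok)) ∷ gapsOK-sound (b ∷ α) (proj₂ (Equivalence.to T-∧ ok))

gapsOK-complete : ∀ {α} → Gapped α → T (gapsOK α)
gapsOK-complete []             = _
gapsOK-complete [-]            = _
gapsOK-complete (gap ∷ gapped) = Equivalence.from T-∧ (ℕ.≤⇒≤ᵇ gap , gapsOK-complete gapped)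

allTuples-sound : ∀ m k → All (λ α → length α ≡ k × All (InRange m) α) (allTuples m k)
allTuples-sound m zero    = (refl , []) ∷ []
allTuples-sound m (suc k) =
  concat⁺ (map⁺ (All.map (λ a∈ → map⁺ (All.map (λ (len , α∈) → cong suc len , a∈ ∷ α∈) (allTuples-sound m k)))
                         (map⁺ (All.map (λ i<1+m → s≤s z≤n , i<1+m) (all-upTo (suc m))))))

∈-allTuples : ∀ {m α} → All (InRange m) α → α ∈ allTuples m (length α)
∈-allTuples []                             = here refl
∈-allTuples {m} {a ∷ α} ((s≤s z≤n , i<1+m) ∷ α∈) =
  ∈-concatMap⁺ (λ b → map (b ∷_) (allTuples m (length α)))
    (Any.map⁺ (lose (∈-applyUpTo⁺ id i<1+m) (∈-map⁺ (a ∷_) (∈-allTuples α∈))))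

gapsOK? : Decidable (λ α → gapsOK α ≡ true)
gapsOK? α = gapsOK α Bool.≟ true

admissible-sound : ∀ m k → All (IsAdmissible m k) (admissible m k)
admissible-sound m k =
  All.zipWith (λ ((len , α∈) , ok) → record
                 { length≡ = len ; inRange = α∈ ; gapped = gapsOK-sound _ (Equivalence.from T-≡ ok) })
              (filter⁺ gapsOK? (allTuples-sound m k) , all-filter gapsOK? (allTuples m k))

admissible-complete : ∀ {m k α} → IsAdmissible m k α → α ∈ admissible m k
admissible-complete {m} {α = α} adm =
  ∈-filter⁺ gapsOK? (subst (λ k → α ∈ allTuples m k) (length≡ adm) (∈-allTuples (inRange adm)))
                    (Equivalence.to T-≡ (gapsOK-complete (gapped adm)))

HasSignedSymbol : ℤ → ℕ → ℕ → Op → Set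
HasSignedSymbol w d k P = ∃[ σ ] HasSymbol w d σ P × OfSign k σ

⨁-signedSymbol : ∀ {w d k P Ps} → All (HasSignedSymbol w d k) Ps → P ∈ Ps → HasSignedSymbol w d k (⨁ Ps)
⨁-signedSymbol {w} {d} {k} {Ps = P ∷ []} (S ∷ []) _ = subst (HasSignedSymbol w d k) (sym (++-identityʳ P)) S
⨁-signedSymbol ((σ , S , sign) ∷ Ss@(_ ∷ _)) _ with σ′ , S′ , sign′ ← ⨁-signedSymbol Ss (here refl) =
  σ + σ′ , ++-symbol S S′ , ofSign-+ sign sign′

⨁-all : ∀ {R : Term → Set} {Ps} → All (All R) Ps → All R (⨁ Ps)
⨁-all = concat⁺

tupleTerm-signedSymbol : ∀ {m h α} → IsAdmissible m (suc h) α → HasSignedSymbol (+ 0) m (suc h) (tupleTerm m (suc h) α)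
tupleTerm-signedSymbol {α = []} adm with () ← length≡ adm
tupleTerm-signedSymbol {m} {h} {a ∷ α} adm@record { inRange = (1≤a , a≤1+m) ∷ _ } =
  tupleProduct m (a ∷ α) ,
  HasSymbol-cong order≡m (ℤ.*-identityˡ _) (tupleTerm-symbol m (suc h) a α) ,
  subst (λ k → OfSign k (tupleProduct m (a ∷ α))) (length≡ adm) (tupleProduct-sign (inRange adm))
  where
  order≡m : (suc m ℕ.∸ a) ℕ.+ prodOrder (a ∷ α) ≡ m
  order≡m = trans (cong ((suc m ℕ.∸ a) ℕ.+_)
                        (prodOrder-descending (Linked.map (ℕ.≤-trans (ℕ.m≤m+n _ 2)) (gapped adm))
                                              (All.map proj₁ (inRange adm))))
                  (∸-telescope 1≤a a≤1+m)

odds : ℕ → List ℕ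
odds zero    = []
odds (suc k) = suc (k ℕ.+ k) ∷ odds k

length-odds : ∀ k → length (odds k) ≡ k
length-odds zero    = refl
length-odds (suc k) = cong suc (length-odds k)

odds-inRange : ∀ {m} h → h ℕ.+ h ≤ m → All (InRange m) (odds (suc h))
odds-inRange zero    _     = (s≤s z≤n , s≤s z≤n) ∷ []
odds-inRange (suc h) 2h≤m  =
  (s≤s z≤n , s≤s 2h≤m) ∷ odds-inRange h (ℕ.≤-trans (ℕ.+-mono-≤ (ℕ.n≤1+n h) (ℕ.n≤1+n h)) 2h≤m)

odds-gapped : ∀ k → Gapped (odds k)
odds-gapped zero          = []
odds-gapped (suc zero)    = [-]
odds-gapped (suc (suc k)) = ℕ.≤-reflexive (gap k) ∷ odds-gapped (suc k)
  where
  gap : ∀ k → suc (k ℕ.+ k) ℕ.+ 2 ≡ suc (suc k ℕ.+ suc k)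
  gap = ℕ-solve-∀

odds-admissible : ∀ {m} h → h ℕ.+ h ≤ m → IsAdmissible m (suc h) (odds (suc h))
odds-admissible h 2h≤m =
  record { length≡ = length-odds (suc h) ; inRange = odds-inRange h 2h≤m ; gapped = odds-gapped (suc h) }

tupleSum : ℕ → ℕ → Op
tupleSum m k = ⨁ (map (tupleTerm m k) (admissible m k))

tupleSum-homogeneous : ∀ m k → Homogeneous (+ 0) (tupleSum m k)
tupleSum-homogeneous m k = ⨁-all (map⁺ (All.universal (tupleTerm-homogeneous m k) (admissible m k)))

tupleSum-signedSymbol : ∀ {m} h → h ℕ.+ h ≤ m → HasSignedSymbol (+ 0) m (suc h) (tupleSum m (suc h))
tupleSum-signedSymbol {m} h 2h≤m =
  ⨁-signedSymbol (map⁺ (All.map tupleTerm-signedSymbol (admissible-sound m (suc h))))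
                 (∈-map⁺ (tupleTerm m (suc h)) (admissible-complete (odds-admissible h 2h≤m)))

-- The operator L̃_m

principalPart : ℕ → Op
principalPart m = uPow (+ 1) ⊗ (ϑ̂ ^ᵒ m)

tuplePart : ℕ → ℕ → Op
tuplePart m k = uPow (+ 1 - + k) ⊗ tupleSum m k

summands : ℕ → ℕ → List Op
summands m n = principalPart m ∷ map (tuplePart m) (map suc (upTo n))

L̃≡⨁summands : ∀ m → L̃ m ≡ ⨁ (summands m (suc ⌊ m /2⌋))
L̃≡⨁summands m = refl

summands-∷ʳ : ∀ m n → summands m (suc n) ≡ summands m n ∷ʳ tuplePart m (suc n)
summands-∷ʳ m n = cong (principalPart m ∷_) (begin
  map (tuplePart m) (map suc (upTo (suc n)))            ≡⟨ cong (map (tuplePart m) ∘ map suc) (applyUpTo-∷ʳ id n) ⟨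
  map (tuplePart m) (map suc (upTo n ∷ʳ n))             ≡⟨ cong (map (tuplePart m)) (map-++ suc (upTo n) (n ∷ [])) ⟩
  map (tuplePart m) (map suc (upTo n) ∷ʳ suc n)         ≡⟨ map-++ (tuplePart m) (map suc (upTo n)) (suc n ∷ []) ⟩
  map (tuplePart m) (map suc (upTo n)) ∷ʳ tuplePart m (suc n) ∎)
  where open ≡-Reasoning

summands-weightAtLeast : ∀ m n → All (WeightAtLeast (+ 1 - + n)) (summands m n)
summands-weightAtLeast m n =
  homogeneous⇒weightAtLeast (ℤ.i-j≤i (+ 1) (+ n))
    (⊗-homogeneous {+ 1} {+ 0} (homogeneous (uPow-symbol (+ 1))) (homogeneous (^ᵒ-symbol m ϑ̂-symbol)))
  ∷ map⁺ (map⁺ (All.map (λ {i} i<n → homogeneous⇒weightAtLeast (weight-bound i<n)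
                          (⊗-homogeneous {+ 1 - + suc i} {+ 0} (homogeneous (uPow-symbol (+ 1 - + suc i))) (tupleSum-homogeneous m (suc i))))
                        (all-upTo n)))
  where
  weight-bound : ∀ {i} → i < n → + 1 - + n ℤ.≤ (+ 1 - + suc i) + + 0
  weight-bound {i} i<n =
    ℤ.≤-trans (ℤ.+-monoʳ-≤ (+ 1) (ℤ.neg-mono-≤ (ℤ.+≤+ i<n))) (ℤ.≤-reflexive (sym (ℤ.+-identityʳ _)))

coeff-⨁-∷ʳ : ∀ Ps P a j → coeff (⨁ (Ps ∷ʳ P)) a j ≡ coeff (⨁ Ps) a j + coeff P a j
coeff-⨁-∷ʳ Ps P a j = begin
  coeff (⨁ (Ps ∷ʳ P)) a j                ≡⟨ cong (λ Q → coeff Q a j) (concat-++ Ps (P ∷ [])) ⟨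
  coeff (⨁ Ps ++ (P ++ [])) a j          ≡⟨ coeff-++ (⨁ Ps) (P ++ []) a j ⟩
  coeff (⨁ Ps) a j + coeff (P ++ []) a j ≡⟨ cong (λ Q → coeff (⨁ Ps) a j + coeff Q a j) (++-identityʳ P) ⟩
  coeff (⨁ Ps) a j + coeff P a j         ∎
  where open ≡-Reasoning

m≡⌊m/2⌋+⌈m/2⌉ : ∀ m → + m ≡ + ⌊ m /2⌋ + + ⌈ m /2⌉
m≡⌊m/2⌋+⌈m/2⌉ m = trans (cong +_ (sym (ℕ.⌊n/2⌋+⌈n/2⌉≡n m))) (ℤ.pos-+ ⌊ m /2⌋ ⌈ m /2⌉)

ℓ-vanishes : ∀ m j a → a ℤ.< + ⌈ m /2⌉ - (+ m - + j) → ℓ m j a ≡ + 0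
ℓ-vanishes m j a a<bound =
  coeff-below-weight {+ 1 - + suc ⌊ m /2⌋} (L̃ m)
    (subst (WeightAtLeast (+ 1 - + suc ⌊ m /2⌋)) (sym (L̃≡⨁summands m)) (⨁-all (summands-weightAtLeast m (suc ⌊ m /2⌋))))
  (subst (a ℤ.<_) (trans (cong (λ x → + ⌈ m /2⌉ - (x - + j)) (m≡⌊m/2⌋+⌈m/2⌉ m)) (shift (+ ⌊ m /2⌋) (+ ⌈ m /2⌉) (+ j)))
         a<bound)
  where
  shift : ∀ h c j → c - ((h + c) - j) ≡ (+ 1 - (+ 1 + h)) + j
  shift = solve-∀

⌊m/2⌋+⌊m/2⌋≤m : ∀ m → ⌊ m /2⌋ ℕ.+ ⌊ m /2⌋ ≤ m
⌊m/2⌋+⌊m/2⌋≤m m = subst (⌊ m /2⌋ ℕ.+ ⌊ m /2⌋ ≤_) (ℕ.⌊n/2⌋+⌈n/2⌉≡n m) (ℕ.+-monoʳ-≤ ⌊ m /2⌋ (ℕ.⌊n/2⌋≤⌈n/2⌉ m))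

tuplePart-signedSymbol : ∀ {m} h → h ℕ.+ h ≤ m →
  HasSignedSymbol ((+ 1 - + suc h) + + 0) m (suc h) (tuplePart m (suc h))
tuplePart-signedSymbol h 2h≤m with σ , S , sign ← tupleSum-signedSymbol h 2h≤m =
  + 1 * σ , ⊗-symbol (uPow-symbol (+ 1 - + suc h)) S , subst (OfSign (suc h)) (sym (ℤ.*-identityˡ σ)) sign

ℓ-leading-sign : ∀ m → OfSign (suc ⌊ m /2⌋) (ℓ m m (+ ⌈ m /2⌉))
ℓ-leading-sign m with σ , S , sign ← tuplePart-signedSymbol ⌊ m /2⌋ (⌊m/2⌋+⌊m/2⌋≤m m) =
  subst (OfSign (suc h)) (sym ℓ≡σ) sign
  where
  open ≡-Reasoning
  h = ⌊ m /2⌋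
  c = ⌈ m /2⌉

  regroup₁ : ∀ h c → (+ 1 - h) + (h + c) ≡ + 1 + c
  regroup₁ = solve-∀
  regroup₂ : ∀ h c → ((+ 1 - (+ 1 + h)) + + 0) + (h + c) ≡ c
  regroup₂ = solve-∀

  c<lowerWeight+m : + c ℤ.< (+ 1 - + h) + + m
  c<lowerWeight+m = subst (+ c ℤ.<_) (sym (trans (cong (_+_ (+ 1 - + h)) (m≡⌊m/2⌋+⌈m/2⌉ m)) (regroup₁ (+ h) (+ c))))
                          (ℤ.+<+ (ℕ.n<1+n c))

  c≡weight+m : + c ≡ ((+ 1 - + suc h) + + 0) + + m
  c≡weight+m = sym (trans (cong (_+_ ((+ 1 - + suc h) + + 0)) (m≡⌊m/2⌋+⌈m/2⌉ m)) (regroup₂ (+ h) (+ c)))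

  ℓ≡σ : ℓ m m (+ c) ≡ σ
  ℓ≡σ = begin
    ℓ m m (+ c)
      ≡⟨ cong (λ P → coeff P (+ c) m) (L̃≡⨁summands m) ⟩
    coeff (⨁ (summands m (suc h))) (+ c) m
      ≡⟨ cong (λ Ps → coeff (⨁ Ps) (+ c) m) (summands-∷ʳ m h) ⟩
    coeff (⨁ (summands m h ∷ʳ tuplePart m (suc h))) (+ c) m
      ≡⟨ coeff-⨁-∷ʳ (summands m h) (tuplePart m (suc h)) (+ c) m ⟩
    coeff (⨁ (summands m h)) (+ c) m + coeff (tuplePart m (suc h)) (+ c) m
      ≡⟨ cong₂ _+_ (coeff-below-weight {+ 1 - + h} (⨁ (summands m h)) (⨁-all (summands-weightAtLeast m h)) c<lowerWeight+m)
                   (trans (cong (λ a → coeff (tuplePart m (suc h)) a m) c≡weight+m) (leading S)) ⟩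
    + 0 + σ
      ≡⟨ ℤ.+-identityˡ σ ⟩
    σ ∎

corollary2p3 : ∀ (m : ℕ) → 1 ≤ m →
    (∀ (j : ℕ) → j ≤ m → MulPowIsPoly (+ m - + j - + ⌊ suc m /2⌋) (ℓ m j))
    × RegularSingularAtZero m (ℓ m)
corollary2p3 m _ =
  (λ j _ a → ℓ-vanishes m j a ∘ polynomial⇒below j a) ,
  (+ ⌈ m /2⌉ , (ofSign⇒≢0 (ℓ-leading-sign m) , λ a → ℓ-vanishes m m a ∘ subst (a ℤ.<_) (sym (c-[m-m]≡c (+ ⌈ m /2⌉) (+ m)))) ,
   λ j _ a → ℓ-vanishes m j a)
  where
  c-[m-m]≡c : ∀ c m → c - (m - m) ≡ c
  c-[m-m]≡c = solve-∀
  polynomial⇒below : ∀ j a → a + (+ m - + j - + ⌈ m /2⌉) ℤ.< + 0 → a ℤ.< + ⌈ m /2⌉ - (+ m - + j)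
  polynomial⇒below j a lt = subst₂ ℤ._<_ (cancel a (+ m) (+ j) (+ ⌈ m /2⌉)) (ℤ.+-identityˡ _) (ℤ.+-monoˡ-< (+ ⌈ m /2⌉ - (+ m - + j)) lt)
    where
    cancel : ∀ a m j c → (a + (m - j - c)) + (c - (m - j)) ≡ a
    cancel = solve-∀
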